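{- Let $G$ be a prime tournament. Then $G$ is both $T_5$-free and $U_5$-free if and only if $V(G)$ can be partitioned into sets $X$, $Y$, $Z$ (some possibly empty) such that $X \cup Y$, $Y \cup Z$, and $Z \cup X$ are each transitive.
   Context: A tournament is a finite loopless directed graph in which for any two distinct vertices $u,v$ there is exactly one edge between them; write $u \rightarrow v$ for the edge from $u$ to $v$. For tournaments $G,H$, $G$ is $H$-free if no induced subtournament of $G$ is isomorphic to $H$. A set $S \subseteq V(G)$ is transitive if the induced subtournament has no cyclic triangle (three vertices $a\rightarrow b\rightarrow c\rightarrow a$). A homogeneous set of $G$ is a set $X \subseteq V(G)$ such that every $v \in V(G)\setminus X$ satisfies either $v \rightarrow x$ for all $x \in X$ or $x \rightarrow v$ for all $x \in X$; it is nontrivial if $1<|X|<|V(G)|$. $G$ is prime if it has no nontrivial homogeneous set. $T_5$ is the tournament on $v_1,\dots,v_5$ with $v_i \rightarrow v_j$ iff $j-i \equiv 1,2 \pmod 5$. $U_5$ is the tournament on $v_1,\dots,v_5$ with $v_2 \rightarrow v_1$, and $v_i \rightarrow v_j$ whenever $j-i\equiv 1,2 \pmod 5$ and $\{i,j\}\neq\{1,2\}$. -}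

module Defs where

open import Data.Nat using (ℕ; _<_; _≤_; suc; zero)
open import Data.Fin using (Fin; zero; suc)
open import Data.Fin.Subset using (Subset; _∈_; _∉_; ∣_∣)
open import Data.Bool using (Bool; true; false)
open import Data.Product using (_×_; Σ; ∃-syntax; _,_)
open import Data.Sum using (_⊎_)
open import Relation.Binary.PropositionalEquality using (_≡_; _≢_)
open import Relation.Nullary using (¬_)
open import Function.Definitions using (Injective)

record Tournament (n : ℕ) : Set where
  field
    adj      : Fin n → Fin n → Bool
    loopless : ∀ u → adj u u ≡ false
    tourn    : ∀ u v → u ≢ v → (adj u v ≡ true × adj v u ≡ false)
                                ⊎ (adj u v ≡ false × adj v u ≡ true)
open Tournament public

_⟶[_]_ : ∀ {n} → Fin n → Tournament n → Fin n → Set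
u ⟶[ G ] v = adj G u v ≡ true

IsInducedSub : ∀ {m n} → Tournament m → Tournament n → Set
IsInducedSub {m} {n} H G =
  Σ (Fin m → Fin n) λ f → Injective _≡_ _≡_ f × (∀ i j → adj H i j ≡ adj G (f i) (f j))

Free : ∀ {m n} → Tournament n → Tournament m → Set
Free G H = ¬ IsInducedSub H G

VSet : ℕ → Set₁
VSet n = Fin n → Set

Transitive : ∀ {n} → Tournament n → VSet n → Set
Transitive G S = ∀ a b c → S a → S b → S c →
  ¬ (a ⟶[ G ] b × b ⟶[ G ] c × c ⟶[ G ] a)

Homogeneous : ∀ {n} → Tournament n → Subset n → Set
Homogeneous G X = ∀ v → v ∉ X →
  (∀ x → x ∈ X → v ⟶[ G ] x) ⊎ (∀ x → x ∈ X → x ⟶[ G ] v)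

NontrivialHom : ∀ {n} → Tournament n → Subset n → Set
NontrivialHom {n} G X = Homogeneous G X × 1 < ∣ X ∣ × ∣ X ∣ < n

Prime : ∀ {n} → Tournament n → Set
Prime G = ∀ X → ¬ NontrivialHom G X

-- circulant-like edge rule on Fin 5 (vertex k stands for v_{k+1}):
-- i → j iff j - i ≡ 1 or 2 (mod 5)
t5 : Fin 5 → Fin 5 → Bool
t5 zero (suc zero) = true
t5 zero (suc (suc zero)) = true
t5 (suc zero) (suc (suc zero)) = true
t5 (suc zero) (suc (suc (suc zero))) = true
t5 (suc (suc zero)) (suc (suc (suc zero))) = true
t5 (suc (suc zero)) (suc (suc (suc (suc zero)))) = true
t5 (suc (suc (suc zero))) (suc (suc (suc (suc zero)))) = true
t5 (suc (suc (suc zero))) zero = true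
t5 (suc (suc (suc (suc zero)))) zero = true
t5 (suc (suc (suc (suc zero)))) (suc zero) = true
t5 _ _ = false

u5 : Fin 5 → Fin 5 → Bool
u5 zero (suc zero) = false
u5 (suc zero) zero = true
u5 i j = t5 i j

private
  v1 v2 v3 v4 v5 : Fin 5
  v1 = zero
  v2 = suc zero
  v3 = suc (suc zero)
  v4 = suc (suc (suc zero))
  v5 = suc (suc (suc (suc zero)))

open import Data.Sum using (inj₁; inj₂)
open import Relation.Binary.PropositionalEquality using (refl)
open import Data.Empty using (⊥-elim)

private
  t5-loop : ∀ u → t5 u u ≡ false
  t5-loop zero = refl
  t5-loop (suc zero) = refl
  t5-loop (suc (suc zero)) = refl
  t5-loop (suc (suc (suc zero))) = refl
  t5-loop (suc (suc (suc (suc zero)))) = refl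

  u5-loop : ∀ u → u5 u u ≡ false
  u5-loop zero = refl
  u5-loop (suc zero) = refl
  u5-loop (suc (suc zero)) = refl
  u5-loop (suc (suc (suc zero))) = refl
  u5-loop (suc (suc (suc (suc zero)))) = refl

  t5-tourn : ∀ u v → u ≢ v → ((t5 u v ≡ true) × (t5 v u ≡ false)) ⊎ ((t5 u v ≡ false) × (t5 v u ≡ true))
  t5-tourn zero zero ne = ⊥-elim (ne refl)
  t5-tourn zero (suc zero) _ = inj₁ (refl , refl)
  t5-tourn zero (suc (suc zero)) _ = inj₁ (refl , refl)
  t5-tourn zero (suc (suc (suc zero))) _ = inj₂ (refl , refl)
  t5-tourn zero (suc (suc (suc (suc zero)))) _ = inj₂ (refl , refl)
  t5-tourn (suc zero) zero _ = inj₂ (refl , refl)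
  t5-tourn (suc zero) (suc zero) ne = ⊥-elim (ne refl)
  t5-tourn (suc zero) (suc (suc zero)) _ = inj₁ (refl , refl)
  t5-tourn (suc zero) (suc (suc (suc zero))) _ = inj₁ (refl , refl)
  t5-tourn (suc zero) (suc (suc (suc (suc zero)))) _ = inj₂ (refl , refl)
  t5-tourn (suc (suc zero)) zero _ = inj₂ (refl , refl)
  t5-tourn (suc (suc zero)) (suc zero) _ = inj₂ (refl , refl)
  t5-tourn (suc (suc zero)) (suc (suc zero)) ne = ⊥-elim (ne refl)
  t5-tourn (suc (suc zero)) (suc (suc (suc zero))) _ = inj₁ (refl , refl)
  t5-tourn (suc (suc zero)) (suc (suc (suc (suc zero)))) _ = inj₁ (refl , refl)
  t5-tourn (suc (suc (suc zero))) zero _ = inj₁ (refl , refl)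
  t5-tourn (suc (suc (suc zero))) (suc zero) _ = inj₂ (refl , refl)
  t5-tourn (suc (suc (suc zero))) (suc (suc zero)) _ = inj₂ (refl , refl)
  t5-tourn (suc (suc (suc zero))) (suc (suc (suc zero))) ne = ⊥-elim (ne refl)
  t5-tourn (suc (suc (suc zero))) (suc (suc (suc (suc zero)))) _ = inj₁ (refl , refl)
  t5-tourn (suc (suc (suc (suc zero)))) zero _ = inj₁ (refl , refl)
  t5-tourn (suc (suc (suc (suc zero)))) (suc zero) _ = inj₁ (refl , refl)
  t5-tourn (suc (suc (suc (suc zero)))) (suc (suc zero)) _ = inj₂ (refl , refl)
  t5-tourn (suc (suc (suc (suc zero)))) (suc (suc (suc zero))) _ = inj₂ (refl , refl)
  t5-tourn (suc (suc (suc (suc zero)))) (suc (suc (suc (suc zero)))) ne = ⊥-elim (ne refl)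
  u5-tourn : ∀ u v → u ≢ v → ((u5 u v ≡ true) × (u5 v u ≡ false)) ⊎ ((u5 u v ≡ false) × (u5 v u ≡ true))
  u5-tourn zero zero ne = ⊥-elim (ne refl)
  u5-tourn zero (suc zero) _ = inj₂ (refl , refl)
  u5-tourn zero (suc (suc zero)) _ = inj₁ (refl , refl)
  u5-tourn zero (suc (suc (suc zero))) _ = inj₂ (refl , refl)
  u5-tourn zero (suc (suc (suc (suc zero)))) _ = inj₂ (refl , refl)
  u5-tourn (suc zero) zero _ = inj₁ (refl , refl)
  u5-tourn (suc zero) (suc zero) ne = ⊥-elim (ne refl)
  u5-tourn (suc zero) (suc (suc zero)) _ = inj₁ (refl , refl)
  u5-tourn (suc zero) (suc (suc (suc zero))) _ = inj₁ (refl , refl)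
  u5-tourn (suc zero) (suc (suc (suc (suc zero)))) _ = inj₂ (refl , refl)
  u5-tourn (suc (suc zero)) zero _ = inj₂ (refl , refl)
  u5-tourn (suc (suc zero)) (suc zero) _ = inj₂ (refl , refl)
  u5-tourn (suc (suc zero)) (suc (suc zero)) ne = ⊥-elim (ne refl)
  u5-tourn (suc (suc zero)) (suc (suc (suc zero))) _ = inj₁ (refl , refl)
  u5-tourn (suc (suc zero)) (suc (suc (suc (suc zero)))) _ = inj₁ (refl , refl)
  u5-tourn (suc (suc (suc zero))) zero _ = inj₁ (refl , refl)
  u5-tourn (suc (suc (suc zero))) (suc zero) _ = inj₂ (refl , refl)
  u5-tourn (suc (suc (suc zero))) (suc (suc zero)) _ = inj₂ (refl , refl)
  u5-tourn (suc (suc (suc zero))) (suc (suc (suc zero))) ne = ⊥-elim (ne refl)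
  u5-tourn (suc (suc (suc zero))) (suc (suc (suc (suc zero)))) _ = inj₁ (refl , refl)
  u5-tourn (suc (suc (suc (suc zero)))) zero _ = inj₁ (refl , refl)
  u5-tourn (suc (suc (suc (suc zero)))) (suc zero) _ = inj₁ (refl , refl)
  u5-tourn (suc (suc (suc (suc zero)))) (suc (suc zero)) _ = inj₂ (refl , refl)
  u5-tourn (suc (suc (suc (suc zero)))) (suc (suc (suc zero))) _ = inj₂ (refl , refl)
  u5-tourn (suc (suc (suc (suc zero)))) (suc (suc (suc (suc zero)))) ne = ⊥-elim (ne refl)

T5 : Tournament 5
T5 = record { adj = t5 ; loopless = t5-loop ; tourn = t5-tourn }

U5 : Tournament 5
U5 = record { adj = u5 ; loopless = u5-loop ; tourn = u5-tourn }

-- V(G) partitioned into X, Y, Z via a colouring c : Fin n → Fin 3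
-- (class 0 = X, class 1 = Y, class 2 = Z); the union of two classes
InClasses : ∀ {n} → (Fin n → Fin 3) → Fin 3 → Fin 3 → VSet n
InClasses c p q v = (c v ≡ p) ⊎ (c v ≡ q)

{-# OPTIONS --safe #-}

-- Two cyclic triangles sharing an arc must give the same colour to their third
-- vertices, so a colouring is propagated from one triangle along walks of
-- triangles in which consecutive ones differ in one vertex.
--
-- Consistency: take a shortest walk at whose ends a vertex v gets different
-- colours. If the walk is a single step, the five vertices involved form T5 or U5.
-- Otherwise v dominates, or is dominated by, all the intermediate triangles, and
-- minimality orients enough arcs between the two ends to exhibit a U5.
--
-- Totality: in a prime tournament a walk from any triangle reaches every vertex,
-- since a vertex that is never reached sees all reached vertices alike. If two
-- cyclic triangles with a common vertex are not linked through shared arcs, then one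
-- of them, with everything linked to it, lies among the vertices that could replace
-- the common vertex in the other one; but walks from it reach every vertex, including
-- the other two vertices of the latter. So all cyclic triangles are linked, hence
-- coloured by the propagation with three different colours.
--
-- Conversely, in both T5 and U5 any two of v₂, v₃, v₄, v₅ lie in a common cyclic
-- triangle, which would take four colours.
module Submission where

open import Defs
open import Data.Nat using (ℕ; zero; suc; _+_; s≤s; z<s; s<s)
import Data.Nat as ℕ
open import Data.Nat.Properties using (n<1+n; m≤m+n; m≤n+m)
open import Data.Nat.Induction using (<-rec)
open import Data.Fin using (Fin; zero; suc; _≟_)
open import Data.Fin.Patterns using (0F; 1F; 2F; 3F; 4F)
open import Data.Fin.Properties using (any?; all?; ¬∀⟶∃¬; pigeonhole)
open import Data.Fin.Subset using (Subset; _∈_; _∉_; ∣_∣; ⊤; ⁅_⁆; _∪_; _⊃_)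
open import Data.Fin.Subset.Properties
  using (_∈?_; ∈⊤; ∣⊤∣≡n; x∈⁅x⁆; x∈⁅y⁆⇒x≡y; ∣⁅x⁆∣≡1; p⊂q⇒∣p∣<∣q∣; p⊆p∪q; q⊆p∪q; x∈p∪q⁻)
open import Data.Fin.Subset.Induction using (⊃-wellFounded; Acc; acc)
open import Data.Bool using (Bool; true; false)
import Data.Bool.Properties as Bool
open import Data.Vec using (lookup; _∷_; [])
open import Data.Vec.Functional using (updateAt)
open import Data.Vec.Functional.Properties using (updateAt-updates; updateAt-minimal)
open import Data.Product using (_×_; Σ; ∃; ∃₂; ∃-syntax; _,_; proj₁; proj₂)
open import Data.Sum using (_⊎_; inj₁; inj₂)
open import Data.Empty using (⊥; ⊥-elim)
open import Function using (const; _∘_)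
open import Function.Bundles using (_⇔_; mk⇔)
open import Relation.Nullary using (¬_; Dec; yes; no; contradiction)
open import Relation.Nullary.Decidable using (_×-dec_; _⊎-dec_; _→-dec_; ¬?; decidable-stable)
open import Relation.Binary.PropositionalEquality
  using (_≡_; _≢_; refl; sym; trans; subst; subst₂; ≢-sym)

-- The cyclic order on the three positions of a triangle, which double as the colours.

data Rot : Fin 3 → Fin 3 → Fin 3 → Set where
  rot₀ : Rot 0F 1F 2F
  rot₁ : Rot 1F 2F 0F
  rot₂ : Rot 2F 0F 1F

private variable
  i j l i′ j′ l′ : Fin 3

rotate : Rot i j l → Rot j l i
rotate rot₀ = rot₁
rotate rot₁ = rot₂
rotate rot₂ = rot₀

rot : ∀ i → ∃₂ λ j l → Rot i j l
rot 0F = _ , _ , rot₀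
rot 1F = _ , _ , rot₁
rot 2F = _ , _ , rot₂

rot-unique : Rot i j l → Rot i j′ l′ → j ≡ j′ × l ≡ l′
rot-unique rot₀ rot₀ = refl , refl
rot-unique rot₁ rot₁ = refl , refl
rot-unique rot₂ rot₂ = refl , refl

rot-≢ : Rot i j l → i ≢ j
rot-≢ rot₀ ()
rot-≢ rot₁ ()
rot-≢ rot₂ ()

rot-connex : ∀ i j → i ≡ j ⊎ (∃ λ l → Rot i j l) ⊎ (∃ λ l → Rot j i l)
rot-connex 0F 0F = inj₁ refl
rot-connex 0F 1F = inj₂ (inj₁ (_ , rot₀))
rot-connex 0F 2F = inj₂ (inj₂ (_ , rot₂))
rot-connex 1F 0F = inj₂ (inj₂ (_ , rot₀))
rot-connex 1F 1F = inj₁ refl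
rot-connex 1F 2F = inj₂ (inj₁ (_ , rot₁))
rot-connex 2F 0F = inj₂ (inj₁ (_ , rot₂))
rot-connex 2F 1F = inj₂ (inj₂ (_ , rot₁))
rot-connex 2F 2F = inj₁ refl

-- Arcs, cyclic triangles and rainbow colourings.

module Arcs {n} (G : Tournament n) where

  infix 4 _⇒_
  _⇒_ : Fin n → Fin n → Set
  u ⇒ v = u ⟶[ G ] v

  private variable
    a b c d u v w x y z : Fin n

  ⇒-irrefl : ¬ u ⇒ u
  ⇒-irrefl {u} e with () ← trans (sym e) (loopless G u)

  ⇒-≢ : u ⇒ v → u ≢ v
  ⇒-≢ e refl = ⇒-irrefl e

  ⇒-asym : u ⇒ v → ¬ v ⇒ u
  ⇒-asym {u} {v} e e′ with tourn G u v (⇒-≢ e)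
  ... | inj₁ (_ , v↛u) with () ← trans (sym v↛u) e′
  ... | inj₂ (u↛v , _) with () ← trans (sym u↛v) e

  ⇒-total : u ≢ v → u ⇒ v ⊎ v ⇒ u
  ⇒-total {u} {v} ne with tourn G u v ne
  ... | inj₁ (e , _) = inj₁ e
  ... | inj₂ (_ , e) = inj₂ e

  ⇒-flip : u ≢ v → ¬ v ⇒ u → u ⇒ v
  ⇒-flip ne v↛u with ⇒-total ne
  ... | inj₁ e = e
  ... | inj₂ e = contradiction e v↛u

  _⇒?_ : ∀ u v → Dec (u ⇒ v)
  u ⇒? v = adj G u v Bool.≟ true

  Cyc : Fin n → Fin n → Fin n → Set
  Cyc a b c = a ⇒ b × b ⇒ c × c ⇒ a

  cyc? : ∀ a b c → Dec (Cyc a b c)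
  cyc? a b c = (a ⇒? b) ×-dec (b ⇒? c) ×-dec (c ⇒? a)

  Rainbow : (Fin n → Fin 3) → Set
  Rainbow c = ∀ {x y z} → Cyc x y z → c x ≢ c y

  -- If two vertices of a cyclic triangle share a colour, its vertices use at most two colours, so
  -- it lies in one of the three unions.
  transitive⇒rainbow : ∀ {c} →
    Transitive G (InClasses c 0F 1F) → Transitive G (InClasses c 1F 2F) →
    Transitive G (InClasses c 2F 0F) → Rainbow c
  transitive⇒rainbow {c} t₀₁ t₁₂ t₂₀ {x} {y} {z} cyc same = go (c x) (c z) refl (sym same) refl
    where
    go : ∀ p q → c x ≡ p → c y ≡ c x → c z ≡ q → ⊥
    go 0F 0F ex ey ez = t₀₁ x y z (inj₁ ex) (inj₁ (trans ey ex)) (inj₁ ez) cyc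
    go 0F 1F ex ey ez = t₀₁ x y z (inj₁ ex) (inj₁ (trans ey ex)) (inj₂ ez) cyc
    go 0F 2F ex ey ez = t₂₀ x y z (inj₂ ex) (inj₂ (trans ey ex)) (inj₁ ez) cyc
    go 1F 0F ex ey ez = t₀₁ x y z (inj₂ ex) (inj₂ (trans ey ex)) (inj₁ ez) cyc
    go 1F 1F ex ey ez = t₁₂ x y z (inj₁ ex) (inj₁ (trans ey ex)) (inj₁ ez) cyc
    go 1F 2F ex ey ez = t₁₂ x y z (inj₁ ex) (inj₁ (trans ey ex)) (inj₂ ez) cyc
    go 2F 0F ex ey ez = t₂₀ x y z (inj₁ ex) (inj₁ (trans ey ex)) (inj₂ ez) cyc
    go 2F 1F ex ey ez = t₁₂ x y z (inj₂ ex) (inj₂ (trans ey ex)) (inj₁ ez) cyc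
    go 2F 2F ex ey ez = t₁₂ x y z (inj₂ ex) (inj₂ (trans ey ex)) (inj₂ ez) cyc

  rainbow⇒transitive : ∀ {c} → Rainbow c → ∀ p q → Transitive G (InClasses c p q)
  rainbow⇒transitive {c} rb p q x y z x∈ y∈ z∈ (e , f , g) = go x∈ y∈ z∈
    where
    xy : c x ≢ c y
    xy = rb (e , f , g)
    yz : c y ≢ c z
    yz = rb (f , g , e)
    zx : c z ≢ c x
    zx = rb (g , e , f)
    go : InClasses c p q x → InClasses c p q y → InClasses c p q z → ⊥
    go (inj₁ ex) (inj₁ ey) _         = xy (trans ex (sym ey))
    go (inj₁ ex) (inj₂ ey) (inj₁ ez) = zx (trans ez (sym ex))
    go (inj₁ ex) (inj₂ ey) (inj₂ ez) = yz (trans ey (sym ez))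
    go (inj₂ ex) (inj₂ ey) _         = xy (trans ex (sym ey))
    go (inj₂ ex) (inj₁ ey) (inj₁ ez) = yz (trans ey (sym ez))
    go (inj₂ ex) (inj₁ ey) (inj₂ ez) = zx (trans ez (sym ex))

  -- Between tournaments, preserving arcs is enough: distinct vertices of `H` span an arc, whose
  -- image joins distinct vertices, and a non-arc between them is a reversed arc.
  arcs⇒induced : ∀ {m} {H : Tournament m} (f : Fin m → Fin n) →
    (∀ i j → adj H i j ≡ true → f i ⇒ f j) → IsInducedSub H G
  arcs⇒induced {H = H} f hom = f , inj , same
    where
    inj : ∀ {i j} → f i ≡ f j → i ≡ j
    inj {i} {j} eq with i ≟ j
    ... | yes i≡j = i≡j
    ... | no i≢j with tourn H i j i≢j
    ...   | inj₁ (e , _) = contradiction eq (⇒-≢ (hom i j e))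
    ...   | inj₂ (_ , e) = contradiction (sym eq) (⇒-≢ (hom j i e))
    same : ∀ i j → adj H i j ≡ adj G (f i) (f j)
    same i j with i ≟ j
    ... | yes refl = trans (loopless H i) (sym (loopless G (f i)))
    ... | no i≢j with tourn H i j i≢j
    ...   | inj₁ (e , _) = trans e (sym (hom i j e))
    ...   | inj₂ (ne , e) = trans ne (sym (Bool.¬-not (⇒-asym (hom j i e))))

  -- Triangles with numbered positions, and replacement of one vertex.

  record Tri : Set where
    field
      vert : Fin 3 → Fin n
      arc  : Rot i j l → vert i ⇒ vert j
  open Tri public

  private variable
    s t t₁ t₂ : Tri
    k m : ℕ

  cyc⇒tri : Cyc a b c → Tri
  cyc⇒tri {a} {b} {c} (e , f , g) = record
    { vert = lookup (a ∷ b ∷ c ∷ [])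
    ; arc  = λ where rot₀ → e
                     rot₁ → f
                     rot₂ → g }

  -- v can take the place of vertex i of t; in particular vertex i itself can.
  record Twin (v : Fin n) (t : Tri) (i : Fin 3) : Set where
    field
      next : Rot i j l → v ⇒ vert t j
      prev : Rot i j l → vert t l ⇒ v
  open Twin

  twin : Rot i j l → v ⇒ vert t j → vert t l ⇒ v → Twin v t i
  twin {v = v} {t = t} r e f = record
    { next = λ r′ → subst (λ p → v ⇒ vert t p) (proj₁ (rot-unique r r′)) e
    ; prev = λ r′ → subst (λ p → vert t p ⇒ v) (proj₂ (rot-unique r r′)) f }

  twin-self : ∀ t i → Twin (vert t i) t i
  twin-self t i = record { next = arc t ; prev = λ r → arc t (rotate (rotate r)) }

  record Step (t t₁ : Tri) : Set where
    constructor step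
    field
      pos  : Fin 3
      same : ∀ q → q ≢ pos → vert t q ≡ vert t₁ q

  step-sym : Step t t₁ → Step t₁ t
  step-sym (step p same) = step p λ q ne → sym (same q ne)

  step-fixes : Step t t₁ → ∀ {p q} → vert t p ≢ vert t₁ p → q ≢ p → vert t q ≡ vert t₁ q
  step-fixes (step i same) {p} {q} moved q≢p with p ≟ i
  ... | yes refl = same q q≢p
  ... | no p≢i = contradiction (same p p≢i) moved

  -- Either the vertex at `p` is common to both triangles, or `p` is the altered position and the
  -- other two vertices are common.
  twin-neighbour : Step t t₁ → ∀ p → Twin (vert t₁ p) t p
  twin-neighbour {t} {t₁} (step i same) p with p ≟ i
  ... | no p≢i = subst (λ x → Twin x t p) (same p p≢i) (twin-self t p)
  ... | yes refl = record
    { next = λ r → subst (vert t₁ p ⇒_) (sym (same _ (≢-sym (rot-≢ r)))) (arc t₁ r)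
    ; prev = λ r → subst (_⇒ vert t₁ p) (sym (same _ (rot-≢ (rotate (rotate r)))))
                     (arc t₁ (rotate (rotate r))) }

  replace : ∀ i → Twin v t i → Tri
  replace {v} {t} i tw = record { vert = updateAt (vert t) i (const v) ; arc = arcs i tw }
    where
    arcs : ∀ i → Twin v t i → Rot j l i′ →
      updateAt (vert t) i (const v) j ⇒ updateAt (vert t) i (const v) l
    arcs 0F tw rot₀ = next tw rot₀
    arcs 0F tw rot₁ = arc t rot₁
    arcs 0F tw rot₂ = prev tw rot₀
    arcs 1F tw rot₀ = prev tw rot₁
    arcs 1F tw rot₁ = next tw rot₁
    arcs 1F tw rot₂ = arc t rot₂
    arcs 2F tw rot₀ = arc t rot₀
    arcs 2F tw rot₁ = prev tw rot₂
    arcs 2F tw rot₂ = next tw rot₂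

  replace-at : (tw : Twin v t i) → vert (replace i tw) i ≡ v
  replace-at {t = t} {i} _ = updateAt-updates i (vert t)

  replace-step : (tw : Twin v t i) → Step t (replace i tw)
  replace-step {t = t} {i} _ = step i λ q q≢i → sym (updateAt-minimal q i (vert t) q≢i)

  twin-replace-next : Rot i j l → (tw : Twin v t i) → w ⇒ vert t l → v ⇒ w →
    Twin w (replace i tw) j
  twin-replace-next {w = w} r tw e f = twin (rotate r)
    (subst (w ⇒_) (Step.same (replace-step tw) _ (rot-≢ (rotate (rotate r)))) e)
    (subst (_⇒ w) (sym (replace-at tw)) f)

  twin-replace-prev : Rot i j l → (tw : Twin v t i) → w ⇒ v → vert t j ⇒ w →
    Twin w (replace i tw) l
  twin-replace-prev {w = w} r tw e f = twin (rotate (rotate r))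
    (subst (w ⇒_) (sym (replace-at tw)) e)
    (subst (_⇒ w) (Step.same (replace-step tw) _ (≢-sym (rot-≢ r))) f)

  -- Walks of triangles

  infixr 5 _∷_ _++_
  infixl 5 _∷ʳ_

  data Walk : ℕ → Tri → Tri → Set where
    []  : Walk 0 t t
    _∷_ : Step t s → Walk k s t₁ → Walk (suc k) t t₁

  _∷ʳ_ : Walk k t s → Step s t₁ → Walk (suc k) t t₁
  []       ∷ʳ st = st ∷ []
  (st ∷ w) ∷ʳ st′ = st ∷ (w ∷ʳ st′)

  uncons : Walk (suc k) t t₁ → ∃ λ s → Step t s × Walk k s t₁
  uncons (st ∷ w) = _ , st , w

  unsnoc : Walk (suc k) t t₁ → ∃ λ s → Walk k t s × Step s t₁
  unsnoc (st ∷ []) = _ , [] , st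
  unsnoc (st ∷ w@(_ ∷ _)) with s , w′ , st′ ← unsnoc w = s , st ∷ w′ , st′

  reverse : Walk k t t₁ → Walk k t₁ t
  reverse [] = []
  reverse (st ∷ w) = reverse w ∷ʳ step-sym st

  _++_ : Walk k t s → Walk m s t₁ → Walk (k + m) t t₁
  []       ++ w′ = w′
  (st ∷ w) ++ w′ = st ∷ (w ++ w′)

  -- The direction of an arc as a value, to treat out- and in-neighbours of v alike.
  Arc : Bool → Fin n → Fin n → Set
  Arc true  u v = u ⇒ v
  Arc false u v = v ⇒ u

  arc-unique : ∀ p q → Arc p u v → Arc q u v → p ≡ q
  arc-unique true  true  _ _ = refl
  arc-unique false false _ _ = refl
  arc-unique true  false e f = contradiction f (⇒-asym e)
  arc-unique false true  e f = contradiction f (⇒-asym e)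

  Uniform : Bool → Fin n → Tri → Set
  Uniform p v t = ∀ i → Arc p v (vert t i)

  -- If `v` is off `t` and both directions occur, then somewhere around `t` an out-neighbour of `v`
  -- is followed by an in-neighbour, and `v` can replace the third vertex.
  twin-or-uniform : ∀ v t → ∃ (Twin v t) ⊎ ∃ λ p → Uniform p v t
  twin-or-uniform v t with any? (λ i → v ≟ vert t i)
  ... | yes (i , refl) = inj₁ (i , twin-self t i)
  ... | no v∉t = go (side 0F) (side 1F) (side 2F)
    where
    side : ∀ i → v ⇒ vert t i ⊎ vert t i ⇒ v
    side i = ⇒-total (λ eq → v∉t (i , eq))
    go : v ⇒ vert t 0F ⊎ vert t 0F ⇒ v → v ⇒ vert t 1F ⊎ vert t 1F ⇒ v →
      v ⇒ vert t 2F ⊎ vert t 2F ⇒ v → ∃ (Twin v t) ⊎ ∃ λ p → Uniform p v t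
    go (inj₁ e) (inj₂ f) _        = inj₁ (2F , twin rot₂ e f)
    go _        (inj₁ e) (inj₂ f) = inj₁ (0F , twin rot₀ e f)
    go (inj₂ f) _        (inj₁ e) = inj₁ (1F , twin rot₁ e f)
    go (inj₁ e) (inj₁ f) (inj₁ g) = inj₂ (true , λ where 0F → e
                                                         1F → f
                                                         2F → g)
    go (inj₂ e) (inj₂ f) (inj₂ g) = inj₂ (false , λ where 0F → e
                                                          1F → f
                                                          2F → g)

  uniform-step : ∀ {p q} → Step t t₁ → Uniform p v t → Uniform q v t₁ → p ≡ q
  uniform-step {v = v} (step i same) U V with rot i
  ... | j , _ , r =
    arc-unique _ _ (subst (Arc _ v) (same j (≢-sym (rot-≢ r))) (U j)) (V j)

  data TwinAlong (v : Fin n) (t t₁ : Tri) (o : ℕ) : Set where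
    split : Walk k t s → Twin v s i → Walk m s t₁ → k + m ≡ o → TwinAlong v t t₁ o

  -- Consecutive triangles share a vertex, so the direction persists until a triangle admits `v` as
  -- a twin; the first such triangle splits the walk.
  scan : ∀ {p} → Walk k t t₁ → Uniform p v t → TwinAlong v t t₁ k ⊎ Uniform p v t₁
  scan [] U = inj₂ U
  scan {v = v} (_∷_ {s = s} st w) U with twin-or-uniform v s
  ... | inj₁ (_ , tw) = inj₁ (split (st ∷ []) tw w refl)
  ... | inj₂ (q , V) with refl ← uniform-step st U V with scan w V
  ...   | inj₁ (split w₁ tw w₂ refl) = inj₁ (split (st ∷ w₁) tw w₂ refl)
  ...   | inj₂ V′ = inj₂ V′

  -- Consistency of the propagated colours

  module Consistency (T5-free : Free G T5) (U5-free : Free G U5) where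

    -- `T5` and `U5` differ only in the arc between their first two vertices, so its direction is
    -- left open.
    no-T5-or-U5 : ∀ {v₁ v₂ v₃ v₄ v₅} → v₁ ≢ v₂ →
      v₁ ⇒ v₃ → v₂ ⇒ v₃ → v₂ ⇒ v₄ → v₃ ⇒ v₄ → v₃ ⇒ v₅ →
      v₄ ⇒ v₅ → v₄ ⇒ v₁ → v₅ ⇒ v₁ → v₅ ⇒ v₂ → ⊥
    no-T5-or-U5 {v₁} {v₂} {v₃} {v₄} {v₅} ne e₁₃ e₂₃ e₂₄ e₃₄ e₃₅ e₄₅ e₄₁ e₅₁ e₅₂ with ⇒-total ne
    ... | inj₁ e₁₂ = T5-free (arcs⇒induced {H = T5} (lookup (v₁ ∷ v₂ ∷ v₃ ∷ v₄ ∷ v₅ ∷ [])) λ where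
      0F 1F refl → e₁₂
      0F 2F refl → e₁₃
      1F 2F refl → e₂₃
      1F 3F refl → e₂₄
      2F 3F refl → e₃₄
      2F 4F refl → e₃₅
      3F 4F refl → e₄₅
      3F 0F refl → e₄₁
      4F 0F refl → e₅₁
      4F 1F refl → e₅₂)
    ... | inj₂ e₂₁ = U5-free (arcs⇒induced {H = U5} (lookup (v₁ ∷ v₂ ∷ v₃ ∷ v₄ ∷ v₅ ∷ [])) λ where
      1F 0F refl → e₂₁
      0F 2F refl → e₁₃
      1F 2F refl → e₂₃
      1F 3F refl → e₂₄
      2F 3F refl → e₃₄
      2F 4F refl → e₃₅
      3F 4F refl → e₄₅
      3F 0F refl → e₄₁
      4F 0F refl → e₅₁
      4F 1F refl → e₅₂)

    -- The hypotheses force all four arcs between the triangles besides those at `v`, and `z₂`,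
    -- `z₁`, `x₂`, `v`, `y₁` in this order form `U5`. The last two hypotheses may assume `z₁ ⇒ z₂`,
    -- which the shorter walks refuting the opposite arcs need.
    bowtie : ∀ {v y₁ z₁ z₂ x₂} → Cyc v y₁ z₁ → Cyc v z₂ x₂ →
      ¬ z₂ ⇒ z₁ → ¬ y₁ ⇒ x₂ → (z₁ ⇒ z₂ → ¬ z₂ ⇒ y₁) → (z₁ ⇒ z₂ → ¬ x₂ ⇒ z₁) → ⊥
    bowtie {v} {y₁} {z₁} {z₂} {x₂} (vy₁ , y₁z₁ , z₁v) (vz₂ , z₂x₂ , x₂v)
           ¬z₂z₁ ¬y₁x₂ ¬z₂y₁ ¬x₂z₁ =
      no-T5-or-U5 (≢-sym (⇒-≢ z₁z₂)) z₂x₂ z₁x₂ z₁v x₂v x₂y₁ vy₁ vz₂ y₁z₂ y₁z₁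
      where
      z₁z₂ : z₁ ⇒ z₂
      z₁z₂ = ⇒-flip (λ { refl → ⇒-asym vz₂ z₁v }) ¬z₂z₁
      x₂y₁ : x₂ ⇒ y₁
      x₂y₁ = ⇒-flip (λ { refl → ⇒-asym vy₁ x₂v }) ¬y₁x₂
      y₁z₂ : y₁ ⇒ z₂
      y₁z₂ = ⇒-flip (λ { refl → ⇒-asym y₁z₁ z₁z₂ }) (¬z₂y₁ z₁z₂)
      z₁x₂ : z₁ ⇒ x₂
      z₁x₂ = ⇒-flip (λ { refl → ⇒-asym z₁z₂ z₂x₂ }) (¬x₂z₁ z₁z₂)

    -- Stated for twins rather than vertices of the end triangles, so that placing `v` there does
    -- not lengthen the walk.
    Consistent : ℕ → Set
    Consistent k = ∀ {t t₁ v i j} → Walk k t t₁ → Twin v t i → Twin v t₁ j → i ≡ j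

    -- Two different positions are consecutive in one order or the other, and reversing the walk
    -- exchanges them.
    consistent-by-rot :
      (∀ {t t₁ v i j l} → Rot i j l → Walk k t t₁ → Twin v t i → ¬ Twin v t₁ j) → Consistent k
    consistent-by-rot clash {i = i} {j} w tw tw₁ with rot-connex i j
    ... | inj₁ i≡j = i≡j
    ... | inj₂ (inj₁ (_ , r)) = contradiction tw₁ (clash r w tw)
    ... | inj₂ (inj₂ (_ , r)) = contradiction tw (clash r (reverse w) tw₁)

    ¬twin-next : Rot i j l → Twin v t i → ¬ Twin v t j
    ¬twin-next r tw tw₁ = ⇒-asym (next tw₁ (rotate r)) (prev tw r)

    -- Write z, z′ for the vertices at `l`. As z ⇒ v ⇒ z′, they differ, so the step changes `l` and
    -- keeps the vertices x, y at `i`, `j`. Then z′, z, x, v, y form `T5` or `U5`, according to the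
    -- arc between z and z′.
    ¬twin-next-step : Rot i j l → Step t t₁ → Twin v t i → ¬ Twin v t₁ j
    ¬twin-next-step {i} {j} {l} {t} {t₁} {v} r st tw tw₁ = no-T5-or-U5
      (≢-sym z≢z′) (subst (vert t₁ l ⇒_) (sym x≡) (arc t₁ (rotate (rotate r))))
      (arc t (rotate (rotate r))) (prev tw r) (subst (_⇒ v) (sym x≡) (prev tw₁ (rotate r)))
      (arc t r) (next tw r) (next tw₁ (rotate r))
      (subst (_⇒ vert t₁ l) (sym y≡) (arc t₁ (rotate r))) (arc t (rotate r))
      where
      z≢z′ : vert t l ≢ vert t₁ l
      z≢z′ eq = ⇒-asym (next tw₁ (rotate r)) (subst (_⇒ v) eq (prev tw r))
      x≡ : vert t i ≡ vert t₁ i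
      x≡ = step-fixes st z≢z′ (≢-sym (rot-≢ (rotate (rotate r))))
      y≡ : vert t j ≡ vert t₁ j
      y≡ = step-fixes st z≢z′ (rot-≢ (rotate r))

    -- In the notation of bowtie, t = (x₁, y₁, z₁) and t₂ = (x₂, y₂, z₂); each arc
    -- in the wrong direction would give a shorter walk with clashing ends.
    ¬twin-next-uniform : ∀ {p} → (∀ {m} → m ℕ.< 2 + k → Consistent m) → Rot i j l →
      Step t s → Walk k s t₁ → Step t₁ t₂ → Uniform p v s → Uniform p v t₁ →
      Twin v t i → ¬ Twin v t₂ j
    ¬twin-next-uniform {k} {i} {j} {l} {t} {s} {t₁} {t₂} {v} {p} IH r st w st₂ U U₁ tw tw₂ =
      bowtie (next tw r , arc t r₁ , prev tw r) (next tw₂ r₁ , arc t₂ r₂ , prev tw₂ r₁)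
        (proj₁ (end-arcs p U U₁)) (proj₂ (end-arcs p U U₁))
        -- Here z₂ would fit at `i` in `t`, but it fits at `l` in `t₁`, one step closer than `t₂`.
        (λ z₁z₂ z₂y₁ → rot-≢ r₂ (sym
          (IH (n<1+n _) (st ∷ w) (twin r z₂y₁ z₁z₂) (twin-neighbour st₂ l))))
        (λ z₁z₂ x₂z₁ → rot-≢ r₁ (sym
          (IH (n<1+n _) (w ∷ʳ st₂) (twin-neighbour (step-sym st) l) (twin r₁ z₁z₂ x₂z₁))))
      where
      r₁ : Rot j l i
      r₁ = rotate r
      r₂ : Rot l i j
      r₂ = rotate r₁
      end-arcs : ∀ p → Uniform p v s → Uniform p v t₁ →
        ¬ vert t₂ l ⇒ vert t l × ¬ vert t j ⇒ vert t₂ i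
      -- Putting `v` into one end triangle costs a step, but two steps are saved at the other end:
      -- the vertex considered there already lies in `t₁` or `s`, hence is a twin in the next
      -- triangle inwards, `s′` or `s″`.
      end-arcs p U U₁ with unsnoc (st ∷ w) | uncons (w ∷ʳ st₂)
      end-arcs true U U₁ | s′ , w′ , st′ | s″ , st″ , w″ =
        (λ z₂z₁ → rot-≢ r₁
          (IH (n<1+n _) (step-sym (replace-step tw) ∷ w′)
            (twin-replace-next r tw z₂z₁ (next tw₂ r₁))
            (subst (λ x → Twin x s′ l) z₂≡ (twin-neighbour st′ l)))) ,
        (λ y₁x₂ → rot-≢ r₁
          (IH (n<1+n _) (w″ ∷ʳ replace-step tw₂)
            (subst (λ x → Twin x s″ j) (sym y₁≡) (twin-neighbour (step-sym st″) j))
            (twin-replace-next r₁ tw₂ y₁x₂ (next tw r))))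
        where
        -- `v` dominates `s` but z₁ ⇒ v, so the first step changes position `l` and keeps y₁; the
        -- other three equalities arise likewise.
        y₁≡ : vert t j ≡ vert s j
        y₁≡ = step-fixes st (λ eq → ⇒-asym (U l) (subst (_⇒ v) eq (prev tw r))) (rot-≢ r₁)
        z₂≡ : vert t₁ l ≡ vert t₂ l
        z₂≡ = step-fixes st₂ (λ eq → ⇒-asym (U₁ i) (subst (_⇒ v) (sym eq) (prev tw₂ r₁))) (rot-≢ r₂)
      end-arcs false U U₁ | s′ , w′ , st′ | s″ , st″ , w″ =
        (λ z₂z₁ → rot-≢ r₂
          (IH (n<1+n _) (w″ ∷ʳ replace-step tw₂)
            (subst (λ x → Twin x s″ l) (sym z₁≡) (twin-neighbour (step-sym st″) l))
            (twin-replace-prev r₁ tw₂ (prev tw r) z₂z₁))) ,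
        (λ y₁x₂ → rot-≢ r₂
          (IH (n<1+n _) (step-sym (replace-step tw) ∷ w′)
            (twin-replace-prev r tw (prev tw₂ r₁) y₁x₂)
            (subst (λ x → Twin x s′ i) x₂≡ (twin-neighbour st′ i))))
        where
        z₁≡ : vert t l ≡ vert s l
        z₁≡ = step-fixes st (λ eq → ⇒-asym (U j) (subst (v ⇒_) eq (next tw r))) (≢-sym (rot-≢ r₁))
        x₂≡ : vert t₁ i ≡ vert t₂ i
        x₂≡ = step-fixes st₂ (λ eq → ⇒-asym (U₁ l) (subst (v ⇒_) (sym eq) (next tw₂ r₁)))
                (≢-sym (rot-≢ r₂))

    consistent : ∀ k → Consistent k
    consistent = <-rec Consistent λ k IH → consistent-by-rot (clash k IH)
      where
      clash : ∀ k → (∀ {m} → m ℕ.< k → Consistent m) →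
        Rot i j l → Walk k t t₁ → Twin v t i → ¬ Twin v t₁ j
      clash _ IH r [] tw tw₁ = ¬twin-next r tw tw₁
      clash _ IH r (st ∷ []) tw tw₁ = ¬twin-next-step r st tw tw₁
      -- If `v` fits into an intermediate triangle, two shorter walks meet there; otherwise it is
      -- uniform, in one direction, to the first and the last of them.
      clash {v = v} (suc (suc k)) IH r (_∷_ {s = s} st w@(_ ∷ _)) tw tw₁
        with twin-or-uniform v s
      ... | inj₁ (_ , tw′) = rot-≢ r
        (trans (IH (s<s z<s) (st ∷ []) tw tw′) (IH (n<1+n _) w tw′ tw₁))
      ... | inj₂ (p , U) with unsnoc w
      ...   | _ , w′ , st′ with scan w′ U
      ...     | inj₂ U₁ = ¬twin-next-uniform IH r st w′ st′ U U₁ tw tw₁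
      ...     | inj₁ (split {k = k₁} {m = k₂} w₁ tw′ w₂ refl) = rot-≢ r
        (trans (IH (s<s (s≤s (m≤m+n k₁ k₂))) (st ∷ w₁) tw tw′)
               (IH (s<s (s≤s (m≤n+m k₂ k₁))) (w₂ ∷ʳ st′) tw′ tw₁))

  -- Primality and linked triangles

  ∣S∣>1 : ∀ {S : Subset n} → u ∈ S → v ∈ S → u ≢ v → 1 ℕ.< ∣ S ∣
  ∣S∣>1 {u} {v} {S} u∈S v∈S u≢v =
    subst (ℕ._< ∣ S ∣) (∣⁅x⁆∣≡1 u) (p⊂q⇒∣p∣<∣q∣
      ( (λ x∈ → subst (_∈ S) (sym (x∈⁅y⁆⇒x≡y u x∈)) u∈S)
      , v , v∈S , λ v∈ → u≢v (sym (x∈⁅y⁆⇒x≡y u v∈)) ))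

  ∣S∣<n : ∀ {S : Subset n} → v ∉ S → ∣ S ∣ ℕ.< n
  ∣S∣<n {v} {S} v∉S =
    subst (∣ S ∣ ℕ.<_) (∣⊤∣≡n n) (p⊂q⇒∣p∣<∣q∣ ((λ _ → ∈⊤) , v , ∈⊤ , v∉S))

  -- Everything involved is decidable on the finite vertex set, so witnesses can be extracted from
  -- the negations.
  ¬homogeneous⇒mixed : ∀ {S} → ¬ Homogeneous G S →
    ∃[ v ] ∃₂ λ a b → v ∉ S × a ∈ S × a ⇒ v × b ∈ S × v ⇒ b
  ¬homogeneous⇒mixed {S} ¬hom =
    let v , ¬P = ¬∀⟶∃¬ n _ (λ v → ¬? (v ∈? S) →-dec (all? (out? v) ⊎-dec all? (in? v))) ¬hom
        v∉S = λ v∈S → ¬P λ v∉S → contradiction v∈S v∉S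
        a , ¬a = ¬∀⟶∃¬ n _ (out? v) λ out → ¬P λ _ → inj₁ out
        b , ¬b = ¬∀⟶∃¬ n _ (in? v) λ inn → ¬P λ _ → inj₂ inn
        a∈S = decidable-stable (a ∈? S) λ a∉S → ¬a λ a∈S → contradiction a∈S a∉S
        b∈S = decidable-stable (b ∈? S) λ b∉S → ¬b λ b∈S → contradiction b∈S b∉S
    in v , a , b , v∉S ,
       a∈S , ⇒-flip (λ a≡v → v∉S (subst (_∈ S) a≡v a∈S)) (λ v⇒a → ¬a λ _ → v⇒a) ,
       b∈S , ⇒-flip (λ v≡b → v∉S (subst (_∈ S) (sym v≡b) b∈S)) (λ b⇒v → ¬b λ _ → b⇒v)
    where
    out? : ∀ v x → Dec (x ∈ S → v ⇒ x)
    out? v x = (x ∈? S) →-dec (v ⇒? x)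
    in? : ∀ v x → Dec (x ∈ S → x ⇒ v)
    in? v x = (x ∈? S) →-dec (x ⇒? v)

  Linked : Tri → Tri → Set
  Linked t t₁ = ∃ λ k → Walk k t t₁

  Reached : Tri → Fin n → Set
  Reached t v = ∃₂ λ t₁ i → Linked t t₁ × vert t₁ i ≡ v

  twin-reached : Linked t t₁ → Twin v t₁ i → Reached t v
  twin-reached (_ , w) tw = _ , _ , (_ , w ∷ʳ replace-step tw) , replace-at tw

  -- On a walk from a triangle through `a` to one through `b`, `v` cannot stay uniform in one
  -- direction, so it is a twin somewhere.
  mixed-reached : Reached t a → Reached t b → a ⇒ v → v ⇒ b → Reached t v
  mixed-reached {v = v} (ta , i , (_ , wa) , refl) (tb , j , (_ , wb) , refl) a⇒v v⇒b
    with twin-or-uniform v ta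
  ... | inj₁ (_ , tw) = twin-reached (_ , wa) tw
  ... | inj₂ (true , U) = contradiction a⇒v (⇒-asym (U i))
  ... | inj₂ (false , U) with scan {p = false} (reverse wa ++ wb) U
  ...   | inj₁ (split w tw _ _) = twin-reached (_ , wa ++ w) tw
  ...   | inj₂ V = contradiction v⇒b (⇒-asym (V j))

  -- A set of reached vertices is grown from two vertices of `t`; as long as it misses `v` it would
  -- be a nontrivial homogeneous set, unless a mixed vertex can be added.
  prime⇒reached : Prime G → ∀ t v → Reached t v
  prime⇒reached prime t v =
    grow (⁅ vert t 0F ⁆ ∪ ⁅ vert t 1F ⁆) (⊃-wellFounded _)
      (p⊆p∪q _ (x∈⁅x⁆ _)) (q⊆p∪q _ _ (x∈⁅x⁆ _)) start
    where
    base : ∀ i → Reached t (vert t i)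
    base i = t , i , (_ , []) , refl
    start : ∀ {x} → x ∈ ⁅ vert t 0F ⁆ ∪ ⁅ vert t 1F ⁆ → Reached t x
    start x∈ with x∈p∪q⁻ ⁅ vert t 0F ⁆ _ x∈
    ... | inj₁ x∈₀ = subst (Reached t) (sym (x∈⁅y⁆⇒x≡y _ x∈₀)) (base 0F)
    ... | inj₂ x∈₁ = subst (Reached t) (sym (x∈⁅y⁆⇒x≡y _ x∈₁)) (base 1F)
    grow : ∀ S → Acc _⊃_ S → vert t 0F ∈ S → vert t 1F ∈ S →
      (∀ {x} → x ∈ S → Reached t x) → Reached t v
    grow S (acc rec) t₀∈S t₁∈S reached with v ∈? S
    ... | yes v∈S = reached v∈S
    ... | no v∉S
      with x , a , b , x∉S , a∈S , a⇒x , b∈S , x⇒b ← ¬homogeneous⇒mixed {S}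
        (λ hom → prime S (hom , ∣S∣>1 t₀∈S t₁∈S (⇒-≢ (arc t rot₀)) , ∣S∣<n v∉S))
      = grow (S ∪ ⁅ x ⁆)
          (rec (p⊆p∪q _ , x , q⊆p∪q S _ (x∈⁅x⁆ x) , x∉S))
          (p⊆p∪q _ t₀∈S) (p⊆p∪q _ t₁∈S) reached′
      where
      reached′ : ∀ {y} → y ∈ S ∪ ⁅ x ⁆ → Reached t y
      reached′ y∈ with x∈p∪q⁻ S _ y∈
      ... | inj₁ y∈S = reached y∈S
      ... | inj₂ y∈x = subst (Reached t) (sym (x∈⁅y⁆⇒x≡y x y∈x))
        (mixed-reached (reached a∈S) (reached b∈S) a⇒x x⇒b)

  -- The arcs ab and cd are linked through cyclic triangles with common arcs.
  data Conn : Fin n → Fin n → Fin n → Fin n → Set where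
    refl       : Conn a b a b
    turn       : Cyc a b c → Conn a b b c
    conn-sym   : Conn a b c d → Conn c d a b
    conn-trans : Conn a b c d → Conn c d u v → Conn a b u v

  conn-arcs : ∀ t → Rot i j l → Rot i′ j′ l′ → Conn (vert t i) (vert t j) (vert t i′) (vert t j′)
  conn-arcs {i} {j} {l} {i′} {j′} {l′} t = go
    where
    cyc : Cyc (vert t 0F) (vert t 1F) (vert t 2F)
    cyc = arc t rot₀ , arc t rot₁ , arc t rot₂
    cyc₁ : Cyc (vert t 1F) (vert t 2F) (vert t 0F)
    cyc₁ = arc t rot₁ , arc t rot₂ , arc t rot₀
    go : Rot i j l → Rot i′ j′ l′ → Conn (vert t i) (vert t j) (vert t i′) (vert t j′)
    go rot₀ rot₀ = refl
    go rot₀ rot₁ = turn cyc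
    go rot₀ rot₂ = conn-trans (turn cyc) (turn cyc₁)
    go rot₁ rot₀ = conn-sym (turn cyc)
    go rot₁ rot₁ = refl
    go rot₁ rot₂ = turn cyc₁
    go rot₂ rot₀ = conn-sym (conn-trans (turn cyc) (turn cyc₁))
    go rot₂ rot₁ = conn-sym (turn cyc₁)
    go rot₂ rot₂ = refl

  -- Any other orientation creates cyclic triangles linking `yz` to `bc`. In the first alternative
  -- every vertex of `abc` could replace `a` in `ayz`; in the second the roles are exchanged.
  nest : Cyc a y z → Cyc a b c → ¬ Conn y z b c →
    c ⇒ y × z ⇒ b × ((b ⇒ y × z ⇒ c) ⊎ (y ⇒ b × c ⇒ z))
  nest {a} {y} {z} {b} {c} (ay , yz , za) (ab , bc , ca) ¬conn = cy , zb , sides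
    where
    yz~ay : Conn y z a y
    yz~ay = conn-sym (turn (ay , yz , za))
    yz~za : Conn y z z a
    yz~za = turn (yz , za , ay)
    ca~bc : Conn c a b c
    ca~bc = conn-trans (turn (ca , ab , bc)) (turn (ab , bc , ca))
    cy : c ⇒ y
    cy = ⇒-flip (λ { refl → ⇒-asym ay ca }) λ yc →
      ¬conn (conn-trans yz~ay (conn-trans (conn-sym (turn (ca , ay , yc))) ca~bc))
    zb : z ⇒ b
    zb = ⇒-flip (λ { refl → ⇒-asym za ab }) λ bz →
      ¬conn (conn-trans yz~za (conn-trans (turn (za , ab , bz)) (turn (ab , bc , ca))))
    y≢b : y ≢ b
    y≢b refl = ¬conn (conn-trans yz~ay (turn (ab , bc , ca)))
    z≢c : z ≢ c
    z≢c refl = ¬conn (conn-trans yz~za ca~bc)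
    sides : (b ⇒ y × z ⇒ c) ⊎ (y ⇒ b × c ⇒ z)
    sides with ⇒-total y≢b | ⇒-total z≢c
    ... | inj₂ by | inj₁ zc = inj₁ (by , zc)
    ... | inj₁ yb | inj₂ cz = inj₂ (yb , cz)
    ... | inj₁ yb | inj₁ zc = ⊥-elim (¬conn
      (conn-trans (conn-sym (turn (cy , yz , zc)))
        (conn-trans (turn (cy , yb , bc)) (turn (yb , bc , cy)))))
    ... | inj₂ by | inj₂ cz = ⊥-elim (¬conn (conn-trans (turn (yz , zb , by)) (turn (zb , bc , cz))))

  record Nested (y z : Fin n) (t : Tri) : Set where
    field
      between : ∀ i → z ⇒ vert t i × vert t i ⇒ y
      apart   : Rot i j l → ¬ Conn y z (vert t i) (vert t j)
  open Nested

  nested-step : y ⇒ z → Nested y z t → Step t t₁ → Nested y z t₁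
  nested-step {y} {z} {t} {t₁} y⇒z N (step i same) with rot i
  ... | j , l , r = record { between = between₁ ; apart = apart₁ }
    where
    r₁ : Rot j l i
    r₁ = rotate r
    r₂ : Rot l i j
    r₂ = rotate r₁
    old : ∀ {q} → q ≢ i → z ⇒ vert t₁ q × vert t₁ q ⇒ y
    old q≢i = subst (λ x → z ⇒ x × x ⇒ y) (same _ q≢i) (between N _)
    jy : z ⇒ vert t₁ j × vert t₁ j ⇒ y
    jy = old (≢-sym (rot-≢ r))
    apart₁ : Rot i′ j′ l′ → ¬ Conn y z (vert t₁ i′) (vert t₁ j′)
    apart₁ r′ conn = apart N r₁ (subst₂ (Conn y z)
      (sym (same _ (≢-sym (rot-≢ r)))) (sym (same _ (rot-≢ r₂)))
      (conn-trans conn (conn-arcs t₁ r′ r₁)))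
    new : z ⇒ vert t₁ i × vert t₁ i ⇒ y
    -- `nest` is applied at the vertex at `j`. Its second alternative has `y` dominate the vertex at
    -- `l`, which is unchanged and dominates `y`.
    new with nest (proj₂ jy , y⇒z , proj₁ jy) (arc t₁ r₁ , arc t₁ r₂ , arc t₁ r) (apart₁ r₂)
    ... | py , _ , inj₁ (_ , zp) = zp , py
    ... | _ , _ , inj₂ (yl , _) = contradiction yl (⇒-asym (proj₂ (old (rot-≢ r₂))))
    between₁ : ∀ q → z ⇒ vert t₁ q × vert t₁ q ⇒ y
    between₁ q with q ≟ i
    ... | yes refl = new
    ... | no q≢i = old q≢i

  nested-walk : y ⇒ z → Nested y z t → Walk k t t₁ → Nested y z t₁
  nested-walk y⇒z N [] = N
  nested-walk y⇒z N (st ∷ w) = nested-walk y⇒z (nested-step y⇒z N st) w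

  -- Nesting survives walks, and by primality a walk from `t` reaches `y`, which would then dominate
  -- itself.
  ¬nested : Prime G → y ⇒ z → ¬ Nested y z t
  ¬nested {y = y} {t = t} prime y⇒z N
    with t₁ , i , (_ , w) , eq ← prime⇒reached prime t y
    = ⇒-irrefl (subst (_⇒ y) eq (proj₂ (between (nested-walk y⇒z N w) i)))

  nested : Cyc a b c → z ⇒ a × a ⇒ y → z ⇒ b × b ⇒ y → z ⇒ c × c ⇒ y →
    ¬ Conn y z b c → ∃ (Nested y z)
  nested cyc a∈ b∈ c∈ ¬conn = cyc⇒tri cyc , record
    { between = λ where 0F → a∈
                        1F → b∈
                        2F → c∈
    ; apart   = λ r conn → ¬conn (conn-trans conn (conn-arcs (cyc⇒tri cyc) r rot₁)) }

  -- Either alternative of `nest` yields a nested triangle. The double negation avoids deciding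
  -- `Conn` and suffices for refuting an equality of colours.
  prime⇒conn : Prime G → Cyc a y z → Cyc a b c → ¬ ¬ Conn y z b c
  prime⇒conn prime ayz@(ay , yz , za) abc@(ab , bc , ca) ¬conn with nest ayz abc ¬conn
  ... | cy , zb , inj₁ (by , zc) =
    ¬nested prime yz (proj₂ (nested abc (za , ay) (zb , by) (zc , cy) ¬conn))
  ... | cy , zb , inj₂ (yb , cz) =
    ¬nested prime bc (proj₂ (nested ayz (ca , ab) (cy , yb) (cz , zb) (¬conn ∘ conn-sym)))

  Covered : Tri → Fin n → Fin n → Set
  Covered t x y = ∃ λ t₁ → Linked t t₁ × ∃₂ λ i j → ∃ λ l →
    Rot i j l × vert t₁ i ≡ x × vert t₁ j ≡ y

  covered-next : Cyc a b c → Covered t a b → Covered t b c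
  covered-next {c = c} (_ , bc , ca) (t₁ , (_ , w) , i , j , l , r , refl , refl) =
    replace l tw , (_ , w ∷ʳ replace-step tw) , j , l , i , rotate r ,
    sym (Step.same (replace-step tw) j (rot-≢ (rotate r))) , replace-at tw
    where
    tw : Twin c t₁ l
    tw = twin (rotate (rotate r)) ca bc

  covered-conn : Conn a b c d → (Covered t a b → Covered t c d) × (Covered t c d → Covered t a b)
  covered-conn refl = (λ cov → cov) , λ cov → cov
  covered-conn (turn cyc@(ab , bc , ca)) =
    -- Two further turns around the same triangle lead back to the first arc.
    covered-next cyc , covered-next (ca , ab , bc) ∘ covered-next (bc , ca , ab)
  covered-conn (conn-sym conn) = proj₂ (covered-conn conn) , proj₁ (covered-conn conn)
  covered-conn (conn-trans conn conn₁) =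
    proj₁ (covered-conn conn₁) ∘ proj₁ (covered-conn conn) ,
    proj₂ (covered-conn conn) ∘ proj₂ (covered-conn conn₁)

  -- Construction of the rainbow colouring.

  free⇒rainbow : Prime G → Free G T5 → Free G U5 → Tri → ∃ Rainbow
  free⇒rainbow prime T5-free U5-free t₀ = colour , rainbow
    where
    open Consistency T5-free U5-free
    reached : ∀ v → Reached t₀ v
    reached = prime⇒reached prime t₀
    colour : Fin n → Fin 3
    -- The position in whichever triangle was found; `colour-twin` shows that the choice does not
    -- matter.
    colour v = proj₁ (proj₂ (reached v))
    colour-twin : Linked t₀ t → Twin v t i → colour v ≡ i
    colour-twin {v = v} (_ , w) tw with reached v
    ... | t₁ , j , (_ , w₁) , refl = consistent _ (reverse w₁ ++ w) (twin-self t₁ j) tw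
    ¬covered : Cyc a b c → colour a ≡ colour b → ¬ Covered t₀ b c
    -- If `bc` occupied positions `i`, `j` of a linked triangle, `a` would fit at `l` and so differ
    -- in colour from `b`.
    ¬covered (ab , _ , ca) same (t , lk , i , j , l , r , refl , refl) = rot-≢ (rotate (rotate r))
      (trans (sym (colour-twin lk (twin (rotate (rotate r)) ab ca)))
        (trans same (colour-twin lk (twin-self t i))))
    rainbow-at : Reached t₀ a → Cyc a b c → colour a ≢ colour b
    rainbow-at (t , i , lk , refl) abc same with j , l , r ← rot i =
      prime⇒conn prime (arc t r , arc t (rotate r) , arc t (rotate (rotate r))) abc λ conn →
        ¬covered abc same
          (proj₁ (covered-conn conn) (t , lk , j , l , i , rotate r , refl , refl))
    rainbow : Rainbow colour
    rainbow = rainbow-at (reached _)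

  cyclic? : Dec (∃[ x ] ∃[ y ] ∃[ z ] Cyc x y z)
  cyclic? = any? λ x → any? λ y → any? λ z → cyc? x y z

  -- Rainbow colourings exclude `T5` and `U5`; assembly of both directions.

  no-rainbow : ∀ {c v₁ v₂ v₃ v₄ v₅} → Cyc v₂ v₃ v₅ → Cyc v₂ v₄ v₅ → Cyc v₃ v₄ v₁ → ¬ Rainbow c
  no-rainbow {c} {_} {v₂} {v₃} {v₄} {v₅} (e₂₃ , e₃₅ , e₅₂) (e₂₄ , e₄₅ , _) cyc₃₄₁ rb
    with pigeonhole (n<1+n 3) (c ∘ lookup (v₂ ∷ v₃ ∷ v₄ ∷ v₅ ∷ []))
  ... | 0F , 1F , _ , eq = rb (e₂₃ , e₃₅ , e₅₂) eq
  ... | 0F , 2F , _ , eq = rb (e₂₄ , e₄₅ , e₅₂) eq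
  ... | 0F , 3F , _ , eq = rb (e₅₂ , e₂₃ , e₃₅) (sym eq)
  ... | 1F , 2F , _ , eq = rb cyc₃₄₁ eq
  ... | 1F , 3F , _ , eq = rb (e₃₅ , e₅₂ , e₂₃) eq
  ... | 2F , 3F , _ , eq = rb (e₄₅ , e₅₂ , e₂₄) eq
  ... | suc _ , 0F , () , _
  ... | 1F , 1F , s<s () , _
  ... | 2F , 1F , s<s () , _
  ... | 3F , 1F , s<s () , _
  ... | 2F , 2F , s<s (s<s ()) , _
  ... | 3F , 2F , s<s (s<s ()) , _
  ... | 3F , 3F , s<s (s<s (s<s ())) , _

module _ {n} (G : Tournament n) where
  open Arcs G

  induced-cyc : ∀ {m} {H : Tournament m} (emb : IsInducedSub H G) → ∀ {i j l} →
    Arcs.Cyc H i j l → Cyc (proj₁ emb i) (proj₁ emb j) (proj₁ emb l)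
  induced-cyc (f , _ , same) (e , e′ , e″) =
    trans (sym (same _ _)) e , trans (sym (same _ _)) e′ , trans (sym (same _ _)) e″

  rainbow⇒T5-free : ∀ {c} → Rainbow c → Free G T5
  rainbow⇒T5-free rb emb = no-rainbow
    (cyc {1F} {2F} {4F} (refl , refl , refl)) (cyc {1F} {3F} {4F} (refl , refl , refl))
    (cyc {2F} {3F} {0F} (refl , refl , refl)) rb
    where cyc = λ {i} {j} {l} → induced-cyc {H = T5} emb {i} {j} {l}

  rainbow⇒U5-free : ∀ {c} → Rainbow c → Free G U5
  rainbow⇒U5-free rb emb = no-rainbow
    (cyc {1F} {2F} {4F} (refl , refl , refl)) (cyc {1F} {3F} {4F} (refl , refl , refl))
    (cyc {2F} {3F} {0F} (refl , refl , refl)) rb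
    where cyc = λ {i} {j} {l} → induced-cyc {H = U5} emb {i} {j} {l}

  prime⇒rainbow : Prime G → Free G T5 → Free G U5 → ∃ Rainbow
  prime⇒rainbow prime T5-free U5-free with cyclic?
  ... | yes (_ , _ , _ , cyc) = free⇒rainbow prime T5-free U5-free (cyc⇒tri cyc)
  ... | no acyclic = const 0F , λ cyc → contradiction (_ , _ , _ , cyc) acyclic

theorem2p5 : ∀ {n} (G : Tournament n) → Prime G →
    (Free G T5 × Free G U5) ⇔
    Σ (Fin n → Fin 3) λ c →
      Transitive G (InClasses c zero (suc zero))
      × Transitive G (InClasses c (suc zero) (suc (suc zero)))
      × Transitive G (InClasses c (suc (suc zero)) zero)
theorem2p5 G prime = mk⇔
  (λ (T5-free , U5-free) → let c , rb = prime⇒rainbow G prime T5-free U5-free in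
    c , rainbow⇒transitive rb _ _ , rainbow⇒transitive rb _ _ , rainbow⇒transitive rb _ _)
  (λ (c , t₀₁ , t₁₂ , t₂₀) → let rb = transitive⇒rainbow t₀₁ t₁₂ t₂₀ in
    rainbow⇒T5-free G rb , rainbow⇒U5-free G rb)
  where open Arcs G
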